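{- Let $\mathscr C$ be a nowhere dense class of graphs and let $r\in\mathbb N$. There is a constant $k$ such that for every graph $G\in\mathscr C$ and every vertex $c\in V(G)$ (a Connector move), there are at most $k$ vertices $s\in V(G)$ that are $r$-progressing against $c$ in $G$.
   Context: A graph class $\mathscr C$ is nowhere dense if for every $d\in\mathbb N$ there is $t$ such that no graph in $\mathscr C$ contains the $d$-subdivision of $K_t$ as a subgraph. For a graph $H$ and vertex $u$, $B^r_H(u)=\{v\in V(H): \mathrm{dist}_H(u,v)\le r\}$. The radius-$r$ Splitter game on a graph $G$ is played by Splitter and Connector in rounds $i=1,2,\dots$ with initial arena $G_1=G$; in round $i$, Connector chooses a vertex $c_i\in V(G_i)$, then Splitter chooses a vertex $s_i\in V(G_i)$ and the new arena is $G_{i+1}=G_i[B^r_{G_i}(c_i)]-s_i$; Splitter wins when $G_{i+1}$ is the empty graph. The $r$-Splitter number of a graph is the minimum $\ell$ such that Splitter has a strategy to win the radius-$r$ game in at most $\ell$ rounds. Given $c\in V(G)$, a vertex $s\in V(G)$ is $r$-progressing against $c$ if the $r$-Splitter number of $G[B^r_G(c)]-s$ is strictly smaller than the $r$-Splitter number of $G[B^r_G(c)]$. -}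

module Defs where

open import Data.Nat using (ℕ; zero; suc; _≤_; _<_)
open import Data.Fin using (Fin; zero; suc; inject₁) renaming (_<_ to _<ᶠ_)
open import Data.Bool using (Bool; true; false)
open import Data.Maybe using (Maybe; just; nothing; maybe)
import Data.Maybe as Maybe
open import Data.Product using (Σ; _×_; ∃; ∃-syntax)
open import Data.Unit using (⊤)
open import Data.List using (List; length)
open import Data.List.Relation.Unary.All using (All)
open import Data.List.Relation.Unary.Unique.Propositional using (Unique)
open import Relation.Binary.PropositionalEquality using (_≡_; _≢_)
open import Relation.Nullary using (¬_)

record Graph : Set where
  field
    n     : ℕ
    adj   : Fin n → Fin n → Bool
    sym   : ∀ u v → adj u v ≡ adj v u
    irrefl : ∀ v → adj v v ≡ false
open Graph public

-- The d-subdivision of K_t (each edge replaced by a path with d inner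
-- vertices), and "G contains it as a subgraph".

data SV (t d : ℕ) : Set where
  branch : Fin t → SV t d
  inner  : (i j : Fin t) → i <ᶠ j → Fin d → SV t d

notLast : (d : ℕ) → Fin (suc d) → Maybe (Fin d)
notLast zero    zero    = nothing
notLast (suc d) zero    = just zero
notLast (suc d) (suc k) = Maybe.map suc (notLast d k)

-- the q-th vertex (q = 0 .. d+1) on the subdivided edge from i to j
pathV : ∀ {t d} (i j : Fin t) → i <ᶠ j → Fin (suc (suc d)) → SV t d
pathV i j h zero        = branch i
pathV {d = d} i j h (suc k) = maybe (inner i j h) (branch j) (notLast d k)

data SE {t d : ℕ} : SV t d → SV t d → Set where
  edge : (i j : Fin t) (h : i <ᶠ j) (k : Fin (suc d)) →
         SE (pathV i j h (inject₁ k)) (pathV i j h (suc k))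

ContainsSubdivK : Graph → (t d : ℕ) → Set
ContainsSubdivK G t d =
  Σ (SV t d → Fin (n G)) λ f →
    (∀ x y → f x ≡ f y → x ≡ y) ×
    (∀ x y → SE x y → adj G (f x) (f y) ≡ true)

NowhereDense : (Graph → Set) → Set
NowhereDense 𝒞 = ∀ (d : ℕ) → ∃[ t ] (∀ G → 𝒞 G → ¬ ContainsSubdivK G t d)

-- Arenas: induced subgraphs G[S], S a set of vertices of G.

module _ (G : Graph) where

  Arena : Set₁
  Arena = Fin (n G) → Set

  -- Reach S r u v : dist_{G[S]}(u,v) ≤ r  (u, v ∈ S, walk inside S)
  data Reach (S : Arena) : ℕ → Fin (n G) → Fin (n G) → Set where
    here : ∀ {r u} → S u → Reach S r u u
    step : ∀ {r u w v} → S u → adj G u w ≡ true → Reach S r w v →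
           Reach S (suc r) u v

  Ball : Arena → ℕ → Fin (n G) → Arena
  Ball S r c v = Reach S r c v

  Remove : Arena → Fin (n G) → Arena
  Remove A s v = A v × v ≢ s

  -- Splitter has a strategy to win the radius-r game on G[S] within ℓ rounds
  Wins : ℕ → Arena → ℕ → Set
  Wins r S zero    = ∀ v → ¬ S v
  Wins r S (suc ℓ) = ∀ c → S c → Σ (Fin (n G)) λ s → S s × Wins r (Remove (Ball S r c) s) ℓ

  SplitterNumber : ℕ → Arena → ℕ → Set
  SplitterNumber r S m = Wins r S m × (∀ ℓ → Wins r S ℓ → m ≤ ℓ)

  AllV : Arena
  AllV _ = ⊤

  Progressing : ℕ → Fin (n G) → Fin (n G) → Set
  Progressing r c s =
    ∃[ m₁ ] ∃[ m₂ ] (SplitterNumber r (Remove (Ball AllV r c) s) m₁ ×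
                     SplitterNumber r (Ball AllV r c) m₂ × m₁ < m₂)

{-# OPTIONS --safe #-}
-- If S has Splitter number greater than ℓ, then so does a subset of S whose size is bounded in
-- terms of r and ℓ alone: take a good Connector move c, an obstruction Y₀ for ℓ avoiding c, for
-- each s in Y₀ an obstruction Y_s avoiding s, and short walks from c to all their vertices.
-- A progressing vertex destroys every obstruction, so it belongs to this bounded one, and it
-- remains to bound the Splitter number on 𝒞.
--
-- For that, let Splitter delete, after each move c_j, the vertices of walks of length at most r
-- from the earlier moves c_i to c_j inside the arenas of these moves.  In a long play, a
-- sunflower argument on the walks leaving one c_i yields a root z (c_i itself, or a vertex on
-- them) from which many walks to later moves are disjoint.  Doing this repeatedly gives many
-- roots, distinct thanks to the deletions, and many moves c_j with disjoint sets D_j through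
-- which all roots are linked to c_j.  Ramsey's theorem makes the lengths of the paths between
-- roots uniform; distributing the pairs of roots over the sets D_j yields a subdivided clique.
module Submission where

open import Defs
open import Level using (Level)
open import Data.Bool using (true)
import Data.Bool.Properties as Bool
open import Data.Fin using (Fin; zero; suc; inject₁; inject≤; combine) renaming (_<_ to _<ᶠ_)
open import Data.Fin.Properties
  using (_≟_; all?; any?; ¬∀⟶∃¬; injective⇒≤; toℕ-inject≤; inject≤-injective; combine-injective)
  renaming (<-cmp to <ᶠ-cmp)
open import Data.List
  using (List; []; _∷_; [_]; _++_; length; map; concatMap; lookup; upTo)
open import Data.List.Extrema.Nat using (max; v≤max⁺)
open import Data.List.Membership.Propositional using (_∈_; _∉_; lose)
open import Data.List.Membership.Propositional.Properties
  using (∈-lookup; ∈-++⁺ˡ; ∈-++⁺ʳ; ∈-++⁻; ∈-map⁺; ∈-concatMap⁺; ∈-upTo⁺; ∈-upTo⁻)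
open import Data.List.Properties using (length-map; length-++; length-upTo)
open import Data.List.Relation.Binary.Disjoint.Propositional using (Disjoint)
open import Data.List.Relation.Binary.Sublist.Propositional
  using ([]; _∷_; _∷ʳ_; minimum; ⊆-refl; ⊆-trans) renaming (_⊆_ to _⊑_)
open import Data.List.Relation.Binary.Sublist.Propositional.Properties
  using (All-resp-⊆; map⁺)
open import Data.List.Relation.Binary.Subset.Propositional using (_⊆_)
open import Data.List.Relation.Binary.Subset.Propositional.Properties using (∷⁺ʳ; ∈-∷⁺ʳ)
open import Data.List.Relation.Unary.All as All using (All; []; _∷_)
import Data.List.Relation.Unary.All.Properties as All
open import Data.List.Relation.Unary.AllPairs as AllPairs using (AllPairs; []; _∷_)
import Data.List.Relation.Unary.AllPairs.Properties as AllPairs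
open import Data.List.Relation.Unary.Any as Any using (Any; here; there)
open import Data.List.Relation.Unary.Any.Properties using (lookup-index)
open import Data.List.Relation.Unary.Unique.Propositional using (Unique)
open import Data.Maybe using (just; nothing; maybe)
open import Data.Nat using (ℕ; zero; suc; _+_; _*_; _^_; _≤_; _<_; z≤n; s≤s)
open import Data.Nat.Properties hiding (_≟_)
open import Data.Product using (∃-syntax; _×_; _,_; proj₁; proj₂)
open import Data.Sum using (_⊎_; inj₁; inj₂)
open import Data.Unit using (tt)
open import Function using (_∘_)
open import Relation.Binary using (Rel; tri<; tri≈; tri>)
open import Relation.Binary.PropositionalEquality
  using (_≡_; _≢_; refl; trans; cong; cong₂; subst) renaming (sym to ≡-sym)
open import Relation.Nullary using (¬_; Dec; yes; no; contradiction)
open import Relation.Nullary.Decidable using (_×-dec_; _→-dec_; ¬?; decidable-stable)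
open import Relation.Unary using (Pred; Decidable; _∪_)

private
  variable
    a p q : Level
    I C : Set a

-- Pigeonhole principle and Ramsey's theorem for lists

AllPairs-resp-⊑ : {R : Rel I p} {xs ys : List I} → ys ⊑ xs → AllPairs R xs → AllPairs R ys
AllPairs-resp-⊑ []         []       = []
AllPairs-resp-⊑ (_ ∷ʳ τ)   (_ ∷ rs) = AllPairs-resp-⊑ τ rs
AllPairs-resp-⊑ (refl ∷ τ) (r ∷ rs) = All-resp-⊆ τ r ∷ AllPairs-resp-⊑ τ rs

AllPairs-lookup : {R : Rel I p} {xs : List I} → AllPairs R xs →
                  ∀ {i j} → i <ᶠ j → R (lookup xs i) (lookup xs j)
AllPairs-lookup (r ∷ rs) {zero}  {suc j} _       = All.lookup r (∈-lookup j)
AllPairs-lookup (r ∷ rs) {suc i} {suc j} (s≤s h) = AllPairs-lookup rs h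

AllPairs-lookup-≡ : {R : Rel I p} {xs : List I} → AllPairs R xs → ∀ {i j} →
                    ¬ R (lookup xs i) (lookup xs j) → ¬ R (lookup xs j) (lookup xs i) → i ≡ j
AllPairs-lookup-≡ rs {i} {j} ¬Rij ¬Rji with <ᶠ-cmp i j
... | tri< i<j _ _ = contradiction (AllPairs-lookup rs i<j) ¬Rij
... | tri≈ _ i≡j _ = i≡j
... | tri> _ _ j<i = contradiction (AllPairs-lookup rs j<i) ¬Rji

All⇒AllPairs : {P : Pred I p} {R : Rel I q} → (∀ {x y} → P x → P y → R x y) →
               ∀ {xs} → All P xs → AllPairs R xs
All⇒AllPairs f []       = []
All⇒AllPairs f (p ∷ ps) = All.map (f p) ps ∷ All⇒AllPairs f ps

-- A sublist, so that `AllPairs` facts about `xs`, among them the order of moves, restrict to it.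
Many : Pred I p → ℕ → List I → Set _
Many P k xs = ∃[ ys ] (ys ⊑ xs × k ≤ length ys × All P ys)

Many-resp-⊑ : {P : Pred I p} {k : ℕ} {xs ys : List I} → ys ⊑ xs → Many P k ys → Many P k xs
Many-resp-⊑ τ (zs , σ , k≤ , ps) = zs , ⊆-trans σ τ , k≤ , ps

Many-∪ : {P : Pred I p} {Q : Pred I q} (j k : ℕ) {xs : List I} → j + k ≤ length xs →
         All (P ∪ Q) xs → Many P j xs ⊎ Many Q k xs
Many-∪ zero    k       _ _ = inj₁ ([] , minimum _ , z≤n , [])
Many-∪ (suc j) zero    _ _ = inj₂ ([] , minimum _ , z≤n , [])
Many-∪ (suc j) (suc k) (s≤s le) (inj₁ p ∷ ps) with Many-∪ j (suc k) le ps
... | inj₁ (ys , τ , j≤ , qs) = inj₁ (_ ∷ ys , refl ∷ τ , s≤s j≤ , p ∷ qs)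
... | inj₂ m                  = inj₂ (Many-resp-⊑ (_ ∷ʳ ⊆-refl) m)
Many-∪ (suc j) (suc k) (s≤s le) (inj₂ q ∷ ps)
  with Many-∪ (suc j) k (≤-trans (≤-reflexive (≡-sym (+-suc j k))) le) ps
... | inj₁ m                  = inj₁ (Many-resp-⊑ (_ ∷ʳ ⊆-refl) m)
... | inj₂ (ys , τ , k≤ , qs) = inj₂ (_ ∷ ys , refl ∷ τ , s≤s k≤ , q ∷ qs)

-- Either the first colour has `k` elements or enough remain for the other colours. The strict
-- inequality makes `xs` nonempty, which settles the case of no colours.
pigeonhole : {R : C → I → Set p} (cs : List C) (k : ℕ) {xs : List I} →
             length cs * k < length xs → All (λ x → Any (λ c → R c x) cs) xs →
             ∃[ c ] (c ∈ cs × Many (R c) k xs)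
pigeonhole []       k _  (() ∷ _)
pigeonhole (c ∷ cs) k lt ps
  with Many-∪ k (suc (length cs * k)) (≤-trans (≤-reflexive (+-suc k _)) lt) (All.map Any.toSum ps)
... | inj₁ m = c , here refl , m
... | inj₂ (ys , τ , lt′ , qs) =
  let c′ , c′∈ , m = pigeonhole cs k lt′ qs in c′ , there c′∈ , Many-resp-⊑ τ m

-- One element is the head; one more gives the strict inequality that `pigeonhole` asks for.
pre-ramsey-bound : ℕ → ℕ → ℕ
pre-ramsey-bound q zero    = 0
pre-ramsey-bound q (suc n) = suc (suc (q * pre-ramsey-bound q n))

-- Every element is listed with the common colour of its pairs with the later ones.
pre-ramsey : {R : C → I → I → Set p} (cs : List C) (n : ℕ) {xs : List I} →
             pre-ramsey-bound (length cs) n ≤ length xs →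
             AllPairs (λ x y → Any (λ c → R c x y) cs) xs →
             ∃[ L ] (map proj₁ L ⊑ xs × length L ≡ n ×
                     AllPairs (λ u v → R (proj₂ u) (proj₁ u) (proj₁ v)) L ×
                     All (λ u → proj₂ u ∈ cs) L)
pre-ramsey cs zero    _         _        = [] , minimum _ , refl , [] , []
pre-ramsey {R = R} cs (suc n) (s≤s le) (_∷_ {x} r rs) =
  let c , c∈ , ys , τ , k≤ , all-c = pigeonhole {R = λ c y → R c x y} cs _ le r
      L , σ , |L| , rs′ , cs∈ = pre-ramsey {R = R} cs n k≤ (AllPairs-resp-⊑ τ rs)
  in (x , c) ∷ L , refl ∷ ⊆-trans σ τ , cong suc |L| ,
     All.map⁻ (All-resp-⊆ σ all-c) ∷ rs′ , c∈ ∷ cs∈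

ramsey-bound : ℕ → ℕ → ℕ
ramsey-bound q n = pre-ramsey-bound q (suc (q * n))

-- Among `suc (q * n)` entries of `L`, `n` share their attached colour, and these are monochromatic.
-- Colours form a relation, since two roots may be joined by paths of several lengths.
ramsey : {R : C → I → I → Set p} (cs : List C) (n : ℕ) {xs : List I} →
         ramsey-bound (length cs) n ≤ length xs →
         AllPairs (λ x y → Any (λ c → R c x y) cs) xs →
         ∃[ c ] (c ∈ cs × ∃[ ys ] (ys ⊑ xs × n ≤ length ys × AllPairs (R c) ys))
ramsey {C = C} {I = I} {R = R} cs n le rs =
  let L , σ , |L| , rs′ , cs∈ = pre-ramsey {R = R} cs (suc (length cs * n)) le rs
      c , c∈ , L′ , τ , n≤ , eqs = pigeonhole cs n (≤-reflexive (≡-sym |L|)) cs∈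
  in c , c∈ , map proj₁ L′ , ⊆-trans (map⁺ proj₁ τ) σ ,
     subst (n ≤_) (≡-sym (length-map proj₁ L′)) n≤ , monochrome eqs (AllPairs-resp-⊑ τ rs′)
  where
  monochrome : ∀ {c} {L : List (I × C)} → All (λ u → proj₂ u ≡ c) L →
               AllPairs (λ u v → R (proj₂ u) (proj₁ u) (proj₁ v)) L → AllPairs (R c) (map proj₁ L)
  monochrome []           []       = []
  monochrome (refl ∷ eqs) (r ∷ rs) = All.map⁺ r ∷ monochrome eqs rs

sublists : List I → List (List I)
sublists []       = [] ∷ []
sublists (x ∷ xs) = map (x ∷_) (sublists xs) ++ sublists xs

length-sublists : (xs : List I) → length (sublists xs) ≡ 2 ^ length xs
length-sublists []       = refl
length-sublists (x ∷ xs) = trans (length-++ (map (x ∷_) (sublists xs)))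
  (cong₂ _+_ (trans (length-map (x ∷_) (sublists xs)) (length-sublists xs))
             (trans (length-sublists xs) (≡-sym (+-identityʳ _))))

∈-sublists : {xs ys : List I} → ys ⊑ xs → ys ∈ sublists xs
∈-sublists []         = here refl
∈-sublists (x ∷ʳ τ)   = ∈-++⁺ʳ _ (∈-sublists τ)
∈-sublists (refl ∷ τ) = ∈-++⁺ˡ (∈-map⁺ _ (∈-sublists τ))

-- Walks

module _ (G : Graph) where

  private
    V : Set
    V = Fin (n G)

  open import Data.List.Membership.DecPropositional (_≟_ {n G}) using (_∈?_)

  -- The list holds the vertices after the first one.
  data Walk : V → List V → V → Set where
    []  : ∀ {u} → Walk u [] u
    _∷_ : ∀ {u w l v} → adj G u w ≡ true → Walk w l v → Walk u (w ∷ l) v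

  after : V → List V → List V
  after v []      = []
  after v (w ∷ l) with v ≟ w
  ... | yes _ = l
  ... | no  _ = after v l

  after-⊆ : ∀ v l → after v l ⊆ l
  after-⊆ v []      ()
  after-⊆ v (w ∷ l) x∈ with v ≟ w
  ... | yes _ = there x∈
  ... | no  _ = there (after-⊆ v l x∈)

  after-< : ∀ {v} l → v ∈ l → length (after v l) < length l
  after-< {v} (w ∷ l) v∈ with v ≟ w | v∈
  ... | yes _   | _         = ≤-refl
  ... | no  v≢w | here v≡w  = contradiction v≡w v≢w
  ... | no  _   | there v∈l = m≤n⇒m≤1+n (after-< l v∈l)

  after-walk : ∀ {x l y v} → Walk x l y → v ∈ l → Walk v (after v l) y
  after-walk {v = v} (_∷_ {w = w} _ p) v∈ with v ≟ w | v∈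
  ... | yes refl | _         = p
  ... | no  v≢w  | here v≡w  = contradiction v≡w v≢w
  ... | no  _    | there v∈l = after-walk p v∈l

  after-unique : ∀ v l → Unique l → Unique (v ∷ after v l)
  after-unique v []      []       = [] ∷ []
  after-unique v (w ∷ l) (u ∷ us) with v ≟ w
  ... | yes refl = u ∷ us
  ... | no  _    = after-unique v l us

  simple-walk : ∀ {x l y} → Walk x l y →
                ∃[ k ] (Walk x k y × k ⊆ l × length k ≤ length l × Unique (x ∷ k))
  simple-walk []      = [] , [] , (λ ()) , z≤n , [] ∷ []
  simple-walk {x} (_∷_ {w = w} e p) with simple-walk p
  ... | k , q , k⊆l , k≤l , us with x ∈? (w ∷ k)
  ...   | yes x∈ = after x (w ∷ k) , after-walk (e ∷ q) x∈ ,
                   (λ v∈ → ∷⁺ʳ w k⊆l (after-⊆ x (w ∷ k) v∈)) ,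
                   ≤-trans (<⇒≤ (after-< (w ∷ k) x∈)) (s≤s k≤l) , after-unique x (w ∷ k) us
  ...   | no  x∉ = w ∷ k , e ∷ q , ∷⁺ʳ w k⊆l , s≤s k≤l , All.¬Any⇒All¬ _ x∉ ∷ us

  adj-sym : ∀ {u v} → adj G u v ≡ true → adj G v u ≡ true
  adj-sym {u} {v} = trans (sym G v u)

  -- The first walk is reversed edge by edge onto the second; with `[]` as second walk this is plain
  -- reversal.
  join-walks : ∀ {u l v m w} → Walk u l v → Walk u m w →
               ∃[ k ] (Walk v k w × k ⊆ (u ∷ l) ++ m × length k ≡ length l + length m)
  join-walks {m = m} [] q = m , q , there , refl
  join-walks {u} {_ ∷ l} {m = m} (e ∷ p) q with join-walks p (adj-sym e ∷ q)
  ... | k , r , k⊆ , |k| = k , r , k⊆′ , trans |k| (+-suc _ _)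
    where
    k⊆′ : k ⊆ (u ∷ _ ∷ l) ++ m
    k⊆′ v∈ with ∈-++⁻ (_ ∷ l) (k⊆ v∈)
    ... | inj₁ v∈l         = ∈-++⁺ˡ (there v∈l)
    ... | inj₂ (here refl) = here refl
    ... | inj₂ (there v∈m) = ∈-++⁺ʳ (u ∷ _ ∷ l) v∈m

  -- d counts the inner vertices of the path, all of which lie in D.
  Path : List V → ℕ → V → V → Set
  Path D d x y = ∃[ a ] ∃[ q ] ∃[ b ] (adj G x a ≡ true × Walk a q b × adj G b y ≡ true ×
                 Unique (a ∷ q) × a ∷ q ⊆ D × length (a ∷ q) ≡ d)

  -- `D` need not contain `x`, so one root can be linked to many targets through pairwise disjoint
  -- sets.
  Linked : ℕ → V → V → List V → Set
  Linked r x v D = ∃[ l ] (Walk x l v × length l ≤ r × l ⊆ D)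

  linked-mono : ∀ {r x v D E} → D ⊆ E → Linked r x v D → Linked r x v E
  linked-mono D⊆E (l , w , l≤ , l⊆D) = l , w , l≤ , λ z∈ → D⊆E (l⊆D z∈)

  -- Neither link is empty, as `v` lies in `D` and `x`, `y` do not. Both thus enter `D` by an edge,
  -- to `a` and `b`, which are joined through `v` inside `D`. At most `(r - 1) + (r - 1)` vertices
  -- follow `a`, so there are fewer than `r + r` inner vertices.
  linked-path : ∀ {r x y v D} → v ∈ D → Linked r x v D × x ∉ D → Linked r y v D × y ∉ D →
                Any (λ d → Path D d x y) (upTo (r + r))
  linked-path v∈ ((_ , []    , _) , x∉) _                   = contradiction v∈ x∉
  linked-path v∈ (_ , _)                ((_ , [] , _) , y∉) = contradiction v∈ y∉
  linked-path {D = D} v∈ ((a ∷ l , e ∷ p , s≤s l≤ , l⊆) , _) ((b ∷ m , f ∷ q , s≤s m≤ , m⊆) , _) =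
    let k , p⁻¹ , k⊆ , |k| = join-walks p []
        j , q⁻¹ , j⊆ , |j| = join-walks q []
        i , w , i⊆ , |i| = join-walks p⁻¹ q⁻¹
        h , w′ , h⊆ , |h| , us = simple-walk w
        h⊆D : h ⊆ D
        h⊆D z∈ = ++-⊆ (∈-∷⁺ʳ v∈ (λ z∈k → ++-⊆ l⊆ (λ ()) (k⊆ z∈k)))
                      (λ z∈j → ++-⊆ m⊆ (λ ()) (j⊆ z∈j)) (i⊆ (h⊆ z∈))
    in lose (∈-upTo⁺ (s≤s (≤-trans
         (s≤s (≤-trans |h| (≤-trans (≤-reflexive |i|) (+-mono-≤
           (≤-trans (≤-reflexive (trans |k| (+-identityʳ _))) l≤)
           (≤-trans (≤-reflexive (trans |j| (+-identityʳ _))) m≤)))))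
         (≤-reflexive (≡-sym (+-suc _ _))))))
       (a , h , b , e , w′ , adj-sym f , us , ∈-∷⁺ʳ (l⊆ (here refl)) h⊆D , refl)
    where
    ++-⊆ : ∀ {xs ys} → xs ⊆ D → ys ⊆ D → xs ++ ys ⊆ D
    ++-⊆ {xs} f g z∈ with ∈-++⁻ xs z∈
    ... | inj₁ z∈xs = f z∈xs
    ... | inj₂ z∈ys = g z∈ys

-- Sunflowers of walks

-- One for the chosen set, `suc (s * k)` for the sets meeting it, the rest for the recursion.
greedy-bound : ℕ → ℕ → ℕ → ℕ
greedy-bound k s zero    = 0
greedy-bound k s (suc m) = suc (suc (s * k) + greedy-bound k s m)

-- The `2 +` accounts for indices with `v` in `D i`: two of them contradict disjointness.
-- `s + suc p` bounds the size of `D i ++ l i`.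
fan-bound : ℕ → ℕ → ℕ → ℕ
fan-bound zero    m s = 2
fan-bound (suc p) m s = greedy-bound (2 + fan-bound p m s) (s + suc p) m

-- Each root uses up a move `e` and a target `f`, and lets the sets `D i` grow by at most `r`.
roots-bound : (r t m s : ℕ) → ℕ
roots-bound r zero    m s = m
roots-bound r (suc t) m s = suc (fan-bound r (suc (roots-bound r t m (s + r))) s)

module _ (G : Graph) {ℓ : Level} {I : Set ℓ} where

  private
    V : Set
    V = Fin (n G)

  open import Data.List.Membership.DecPropositional (_≟_ {n G}) using (_∈?_)

  Apart : (I → List V) → I → I → Set
  Apart D i j = Disjoint (D i) (D j)

  apart-∈ : ∀ {D v J} → 2 ≤ length J → AllPairs (Apart D) J → ¬ All (λ i → v ∈ D i) J
  apart-∈ (s≤s (s≤s _)) ((d ∷ _) ∷ _) (v∈ ∷ v∈′ ∷ _) = d (v∈ , v∈′)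

  -- If few sets meet the first one, it is kept and they are dropped. If many do, one of its at most
  -- `s` vertices lies in `k` of them.
  greedy : ∀ k s m (S : I → List V) {J} → greedy-bound k s m ≤ length J →
           All (λ i → length (S i) ≤ s) J →
           (∃[ J′ ] (J′ ⊑ J × m ≤ length J′ × AllPairs (Apart S) J′)) ⊎
           (∃[ v ] Many (λ i → v ∈ S i) k J)
  greedy k s zero    S _ _ = inj₁ ([] , minimum _ , z≤n , [])
  greedy k s (suc m) S {j ∷ J} (s≤s le) (b ∷ bs)
    with Many-∪ (suc (s * k)) (greedy-bound k s m) le (All.universal meets? J)
    where
    meets? : ∀ i → Any (λ v → v ∈ S i) (S j) ⊎ Apart S j i
    meets? i with Any.any? (_∈? S i) (S j)
    ... | yes meets = inj₁ meets
    ... | no  ¬meets = inj₂ (λ (v∈ , v∈′) → ¬meets (lose v∈ v∈′))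
  ... | inj₁ (ys , τ , lt , as) =
    let v , _ , many = pigeonhole {R = λ v i → v ∈ S i} (S j) k
                         (≤-trans (s≤s (*-monoˡ-≤ k b)) lt) as
    in inj₂ (v , Many-resp-⊑ (j ∷ʳ τ) many)
  ... | inj₂ (ys , τ , le′ , as) with greedy k s m S le′ (All-resp-⊆ τ bs)
  ...   | inj₁ (zs , σ , m≤ , ap) =
    inj₁ (j ∷ zs , refl ∷ ⊆-trans σ τ , s≤s m≤ , All-resp-⊆ σ as ∷ ap)
  ...   | inj₂ (v , many) = inj₂ (v , Many-resp-⊑ (j ∷ʳ τ) many)

  module _ (c : I → V) where

    -- `B` stays fixed while the centre moves, so the final centre still lies on the original
    -- routes.
    Leg : (I → List V) → ℕ → V → (I → List V) → I → Set
    Leg B p x l i = Walk G x (l i) (c i) × length (l i) ≤ p × x ∷ l i ⊆ B i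

    -- A vertex v on many legs becomes the new centre and shortens these legs, so this ends after p
    -- steps; the sets D i take part because the new legs must also avoid each other's D.
    fan : ∀ p m s x (D l B : I → List V) {J} → fan-bound p m s ≤ length J →
          All (Leg B p x l) J → All (λ i → length (D i) ≤ s) J →
          AllPairs (Apart D) J → All (λ i → c i ∈ D i) J →
          ∃[ z ] ∃[ k ] ∃[ J′ ] (J′ ⊑ J × m ≤ length J′ × All (Leg B p z k) J′ ×
                                 AllPairs (Apart (λ i → D i ++ k i)) J′)
    -- Legs of length 0 make `x` equal to `c i` for two indices with disjoint `D i`.
    fan zero m s x D l B two≤ legs _ apart c∈ =
      contradiction (All.zipWith x∈D (legs , c∈)) (apart-∈ two≤ apart)
      where
      x∈D : ∀ {i} → Leg B zero x l i × c i ∈ D i → x ∈ D i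
      x∈D {i} (leg , c∈) with l i | leg
      ... | [] | [] , _ = c∈
    fan (suc p) m s x D l B le legs sizes apart c∈
      with greedy (2 + fan-bound p m s) (s + suc p) m (λ i → D i ++ l i) le
             (All.zipWith size (sizes , legs))
      where
      size : ∀ {i} → length (D i) ≤ s × Leg B (suc p) x l i → length (D i ++ l i) ≤ s + suc p
      size {i} (D≤ , _ , l≤ , _) = ≤-trans (≤-reflexive (length-++ (D i))) (+-mono-≤ D≤ l≤)
    ... | inj₁ (J′ , τ , m≤ , ap) = x , l , J′ , τ , m≤ , All-resp-⊆ τ legs , ap
    ... | inj₂ (v , J₁ , τ , le₁ , v∈)
      with Many-∪ 2 (fan-bound p m s) le₁ (All.map (∈-++⁻ _) v∈)
    ...   | inj₁ (J₂ , σ , two≤ , v∈D) =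
      contradiction v∈D (apart-∈ two≤ (AllPairs-resp-⊑ (⊆-trans σ τ) apart))
    ...   | inj₂ (J₂ , σ , le₂ , v∈l) =
      let ρ = ⊆-trans σ τ
          z , k , J₃ , π , m≤ , legs′ , ap = fan p m s v D (λ i → after G v (l i)) B le₂
            (All.zipWith cut (All-resp-⊆ ρ legs , v∈l)) (All-resp-⊆ ρ sizes)
            (AllPairs-resp-⊑ ρ apart) (All-resp-⊆ ρ c∈)
      in z , k , J₃ , ⊆-trans π ρ , m≤ ,
         All.map (relax k) legs′ , ap
      where
      relax : ∀ {z} k {i} → Leg B p z k i → Leg B (suc p) z k i
      relax k (w , k≤ , k⊆) = w , m≤n⇒m≤1+n k≤ , k⊆
      cut : ∀ {i} → Leg B (suc p) x l i × v ∈ l i → Leg B p v (λ i → after G v (l i)) i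
      cut {i} ((w , l≤ , l⊆) , v∈l) =
        after-walk G w v∈l , ≤-pred (≤-trans (after-< G (l i) v∈l) l≤) ,
        λ z∈ → l⊆ (there (∈-∷⁺ʳ v∈l (after-⊆ G v (l i)) z∈))

    -- A e is the arena in which the move c e is made, and P e f the route from c e to a later c f.
    module _ (A : I → V → Set) (P : I → I → List V) (r : ℕ) where

      Sees : I → I → Set
      Sees e f = Walk G (c e) (P e f) (c f) × length (P e f) ≤ r × All (A e) (c e ∷ P e f)

      sees-leg : ∀ {e f} → Sees e f → Leg (λ g → c e ∷ P e g) r (c e) (P e) f
      sees-leg (w , l≤ , _) = w , l≤ , λ z∈ → z∈

      -- The third condition of `move`: for `e`, `f`, `g` in order of play, the route from `e` to
      -- `f` is absent from the arena of `g`.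
      data Play : List I → Set ℓ where
        []   : Play []
        move : ∀ {e es} → All (Sees e) es → All (λ f → c e ≢ c f) es →
               AllPairs (λ f g → All (λ v → ¬ A g v) (c e ∷ P e f)) es →
               Play es → Play (e ∷ es)

      play-resp-⊑ : ∀ {es fs} → fs ⊑ es → Play es → Play fs
      play-resp-⊑ []         []                  = []
      play-resp-⊑ (_ ∷ʳ τ)   (move _ _ _ g)      = play-resp-⊑ τ g
      play-resp-⊑ (refl ∷ τ) (move see ne far g) =
        move (All-resp-⊆ τ see) (All-resp-⊆ τ ne) (AllPairs-resp-⊑ τ far) (play-resp-⊑ τ g)

      play-∷ʳ : ∀ {es e} → Play es → All (λ f → Sees f e) es → All (λ f → c f ≢ c e) es →
                AllPairs (λ f g → All (λ v → ¬ A e v) (c f ∷ P f g)) es → Play (es ++ [ e ])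
      play-∷ʳ [] [] [] [] = move [] [] [] []
      play-∷ʳ (move see ne far g) (s ∷ ss) (n ∷ ns) (a ∷ as) =
        move (All.∷ʳ⁺ see s) (All.∷ʳ⁺ ne n) (AllPairs.++⁺ far ([] ∷ []) (All.map (_∷ []) a))
             (play-∷ʳ g ss ns as)

      play-distinct : ∀ {es} → Play es → AllPairs (λ e f → c e ≢ c f) es
      play-distinct []              = []
      play-distinct (move _ ne _ g) = ne ∷ play-distinct g

      record Rooted (X : List V) (D : I → List V) (J : List I) : Set ℓ where
        field
          distinct : Unique X
          linked   : All (λ i → All (λ x → Linked G r x (c i) (D i)) X) J
          apart    : AllPairs (Apart D) J
          c∈D      : All (λ i → c i ∈ D i) J
      open Rooted

      -- Each round applies `fan` to the routes from the first move `e`. The new root `z` lies in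
      -- the arena of `e`, which contains no old root, and in no arena of the moves kept.
      roots : ∀ t m s {X D J} → roots-bound r t m s ≤ length J → Play J →
              Rooted X D J → All (λ i → All (λ x → ¬ A i x) X) J →
              All (λ i → length (D i) ≤ s) J →
              ∃[ X′ ] ∃[ D′ ] ∃[ J′ ] (length X′ ≡ t + length X × m ≤ length J′ × Rooted X′ D′ J′)
      roots zero    m s le _ R _ _ = _ , _ , _ , refl , le , R
      roots (suc t) m s {X} {D} {e ∷ J} (s≤s le) (move see ne far g) R (avoid ∷ avoids) (_ ∷ sizes)
        with fan r (suc (roots-bound r t m (s + r))) s (c e) D (P e) (λ f → c e ∷ P e f) le
               (All.map sees-leg see) sizes
               (AllPairs.tail (apart R)) (All.tail (c∈D R))
      ... | z , k , f ∷ J′ , τ , s≤s m≤ , leg₀ ∷ legs , _ ∷ apart′ =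
        let X′ , D′ , J″ , |X′| , m≤′ , R′ = roots t m (s + r) m≤
              (play-resp-⊑ ρ g)
              (record { distinct = z≢X ∷ distinct R
                      ; linked = All.zipWith links (legs , All-resp-⊆ ρ (All.tail (linked R)))
                      ; apart = apart′
                      ; c∈D = All.map ∈-++⁺ˡ (All-resp-⊆ ρ (All.tail (c∈D R))) })
              (All.zipWith (λ (a , b) → a ∷ b) (z-avoided , All-resp-⊆ ρ avoids))
              (All.zipWith size (All-resp-⊆ ρ sizes , legs))
        in X′ , D′ , J″ , trans |X′| (+-suc t (length X)) , m≤′ , R′
        where
        -- The target f is given up: z lies on the route from c e to c f, hence in no later arena.
        ρ : J′ ⊑ J
        ρ = ⊆-trans (f ∷ʳ ⊆-refl) τ
        z∈ : z ∈ c e ∷ P e f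
        z∈ = proj₂ (proj₂ leg₀) (here refl)
        z∈A : A e z
        z∈A = All.lookup (proj₂ (proj₂ (All.head (All-resp-⊆ τ see)))) z∈
        z≢X : All (z ≢_) X
        z≢X = All.map (λ x∉A z≡x → x∉A (subst (A e) z≡x z∈A)) avoid
        z-avoided : All (λ g → ¬ A g z) J′
        z-avoided = All.map (λ ¬A → All.lookup ¬A z∈) (AllPairs.head (AllPairs-resp-⊑ τ far))
        links : ∀ {i} → Leg (λ f → c e ∷ P e f) r z k i × All (λ x → Linked G r x (c i) (D i)) X →
                All (λ x → Linked G r x (c i) (D i ++ k i)) (z ∷ X)
        links ((w , k≤ , _) , ls) =
          (_ , w , k≤ , ∈-++⁺ʳ _) ∷ All.map (linked-mono G ∈-++⁺ˡ) ls
        size : ∀ {i} → length (D i) ≤ s × Leg (λ f → c e ∷ P e f) r z k i →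
               length (D i ++ k i) ≤ s + r
        size {i} (D≤ , _ , k≤ , _) = ≤-trans (≤-reflexive (length-++ (D i))) (+-mono-≤ D≤ k≤)

-- Subdivided cliques

module _ (G : Graph) where

  private
    V : Set
    V = Fin (n G)

  Chain : (d : ℕ) → V → V → (Fin d → V) → Set
  Chain zero    x y g = adj G x y ≡ true
  Chain (suc d) x y g = adj G x (g zero) ≡ true × Chain d (g zero) y (g ∘ suc)

  -- Shares the case distinction of `pathV`, so that `f-pathV` follows by cases on `notLast`.
  chainV : ∀ {d} → V → V → (Fin d → V) → Fin (suc (suc d)) → V
  chainV         x y g zero    = x
  chainV {d = d} x y g (suc k) = maybe g y (notLast d k)

  chainV-tail : ∀ {d} (y : V) (g : Fin (suc d) → V) k →
                maybe g y (notLast (suc d) k) ≡ chainV (g zero) y (g ∘ suc) k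
  chainV-tail         y g zero    = refl
  chainV-tail {d = d} y g (suc k) with notLast d k
  ... | nothing = refl
  ... | just _  = refl

  chainV-adj : ∀ {d x y g} → Chain d x y g → ∀ k →
               adj G (chainV x y g (inject₁ k)) (chainV x y g (suc k)) ≡ true
  chainV-adj {zero}          e       zero    = e
  chainV-adj {suc d}         (e , _) zero    = e
  chainV-adj {suc d} {y = y} {g} (_ , ch) (suc k) =
    trans (cong₂ (adj G) (chainV-tail y g (inject₁ k)) (chainV-tail y g (suc k))) (chainV-adj ch k)

  walk-chain : ∀ {x a q b y} → adj G x a ≡ true → Walk G a q b → adj G b y ≡ true →
               Chain (suc (length q)) x y (lookup (a ∷ q))
  walk-chain e []      f = e , f
  walk-chain e (e′ ∷ w) f = e , walk-chain e′ w f

  path-chain : ∀ {D d x y} → Path G D d x y →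
               ∃[ g ] (Chain d x y g × (∀ p q → g p ≡ g q → p ≡ q) × (∀ p → g p ∈ D))
  path-chain (a , q , b , e , w , f , us , q⊆D , refl) =
    lookup (a ∷ q) , walk-chain e w f ,
    (λ i j eq → AllPairs-lookup-≡ us (λ ne → ne eq) (λ ne → ne (≡-sym eq))) ,
    λ p → q⊆D (∈-lookup p)

  module _ {ℓ : Level} {I : Set ℓ} (D : I → List V) where

    -- Each pair of branch vertices gets a set of its own through `combine`. Disjointness separates
    -- the segments from each other, and avoidance of `Y` separates them from the branch vertices.
    subdivision : ∀ t d Y J → Unique Y → t ≤ length Y → t * t ≤ length J →
                  AllPairs (Apart G D) J → All (λ j → All (_∉ D j) Y) J →
                  All (λ j → AllPairs (Path G (D j) d) Y) J → ContainsSubdivK G t d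
    subdivision t d Y J distinct t≤ t²≤ apart avoids paths = f , f-injective , f-edge
      where
      y : Fin t → V
      y i = lookup Y (inject≤ i t≤)

      e : Fin t → Fin t → I
      e i j = lookup J (inject≤ (combine i j) t²≤)

      y-injective : ∀ i j → y i ≡ y j → i ≡ j
      y-injective i j eq = inject≤-injective t≤ t≤ i j
        (AllPairs-lookup-≡ distinct (λ ne → ne eq) (λ ne → ne (≡-sym eq)))

      e-injective : ∀ i j i′ j′ {v} → v ∈ D (e i j) → v ∈ D (e i′ j′) → i ≡ i′ × j ≡ j′
      e-injective i j i′ j′ v∈ v∈′ = combine-injective i j i′ j′ (inject≤-injective t²≤ t²≤ _ _
        (AllPairs-lookup-≡ apart (λ d → d (v∈ , v∈′)) (λ d → d (v∈′ , v∈))))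

      segment : ∀ i j → i <ᶠ j →
                ∃[ g ] (Chain d (y i) (y j) g × (∀ p q → g p ≡ g q → p ≡ q) ×
                        (∀ p → g p ∈ D (e i j)))
      segment i j i<j = path-chain (AllPairs-lookup (All.lookup paths (∈-lookup _))
        (≤-trans (s≤s (≤-reflexive (toℕ-inject≤ i t≤)))
                 (≤-trans i<j (≤-reflexive (≡-sym (toℕ-inject≤ j t≤))))))

      f : SV t d → V
      f (branch i)        = y i
      f (inner i j i<j k) = proj₁ (segment i j i<j) k

      inner∈D : ∀ i j (h : i <ᶠ j) k → f (inner i j h k) ∈ D (e i j)
      inner∈D i j h = proj₂ (proj₂ (proj₂ (segment i j h)))

      y∉D : ∀ i i′ j′ → y i ∉ D (e i′ j′)
      y∉D i i′ j′ = All.lookup (All.lookup avoids (∈-lookup _)) (∈-lookup _)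

      f-injective : ∀ u v → f u ≡ f v → u ≡ v
      f-injective (branch i) (branch j) eq = cong branch (y-injective i j eq)
      f-injective (branch i) (inner i′ j′ h k) eq =
        contradiction (subst (_∈ _) (≡-sym eq) (inner∈D i′ j′ h k)) (y∉D i i′ j′)
      f-injective (inner i j h k) (branch i′) eq =
        contradiction (subst (_∈ _) eq (inner∈D i j h k)) (y∉D i′ i j)
      f-injective (inner i j h k) (inner i′ j′ h′ k′) eq
        with e-injective i j i′ j′ (inner∈D i j h k) (subst (_∈ _) (≡-sym eq) (inner∈D i′ j′ h′ k′))
      ... | refl , refl with ≤-irrelevant h h′
      ... | refl = cong (inner i j h) (proj₁ (proj₂ (proj₂ (segment i j h))) k k′ eq)

      f-pathV : ∀ i j h k → f (pathV i j h k) ≡ chainV (y i) (y j) (proj₁ (segment i j h)) k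
      f-pathV i j h zero = refl
      f-pathV i j h (suc k) with notLast d k
      ... | nothing = refl
      ... | just _  = refl

      f-edge : ∀ u v → SE u v → adj G (f u) (f v) ≡ true
      f-edge _ _ (edge i j h k) =
        trans (cong₂ (adj G) (f-pathV i j h (inject₁ k)) (f-pathV i j h (suc k)))
              (chainV-adj (proj₁ (proj₂ (segment i j h))) k)

    -- A vertex lies in at most one of the disjoint sets, so `Many-∪` cannot find two containing it;
    -- asking for two costs 2 per vertex.
    avoiding : ∀ k X {J} → k + length X * 2 ≤ length J → AllPairs (Apart G D) J →
               Many (λ j → All (_∉ D j) X) k J
    avoiding k []      {J} le _ =
      J , ⊆-refl , ≤-trans (m≤m+n k 0) le , All.universal (λ _ → []) J
    avoiding k (x ∷ X) le apart
      with avoiding (2 + k) X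
             (≤-trans (≤-reflexive (≡-sym (trans (+-suc k _) (cong suc (+-suc k _))))) le) apart
    ... | J₁ , τ , le₁ , avoid with Many-∪ 2 k le₁ (All.universal ∈⊎∉ J₁)
      where
      open import Data.List.Membership.DecPropositional (_≟_ {n G}) using (_∈?_)
      ∈⊎∉ : ∀ j → x ∈ D j ⊎ x ∉ D j
      ∈⊎∉ j with x ∈? D j
      ... | yes x∈ = inj₁ x∈
      ... | no  x∉ = inj₂ x∉
    ...   | inj₁ (J₂ , σ , two≤ , x∈) =
      contradiction x∈ (apart-∈ G two≤ (AllPairs-resp-⊑ (⊆-trans σ τ) apart))
    ...   | inj₂ (J₂ , σ , k≤ , x∉) =
      J₂ , ⊆-trans σ τ , k≤ , All.zipWith (λ (a , b) → a ∷ b) (x∉ , All-resp-⊆ σ avoid)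

-- Subdivided cliques from long plays

root-count : ℕ → ℕ → ℕ
root-count r T = ramsey-bound (r + r) T

-- Room for two pigeonholes, over the lengths below `r + r` and over the sublists of the roots,
-- leaving more than `T * T` targets.
target-count : ℕ → ℕ → ℕ
target-count r T = suc ((r + r) * suc (2 ^ root-count r T * suc (T * T)))

play-bound : ℕ → ℕ → ℕ
play-bound r T = roots-bound r (root-count r T) (target-count r T + root-count r T * 2) 1

module _ (G : Graph) {ℓ : Level} {I : Set ℓ} (c : I → Fin (n G))
         (A : I → Fin (n G) → Set) (P : I → I → List (Fin (n G))) (r : ℕ) where

  -- In each `D j`, Ramsey's theorem gives a set of roots joined by paths of one length. Length and
  -- set depend on `j`; the two pigeonholes over `j` fix them.
  rooted-subdivision : ∀ T {X D J} → length X ≡ root-count r T →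
                       target-count r T + length X * 2 ≤ length J → Rooted G c A P r X D J →
                       ∃[ d ] (d < r + r × (∀ t → t ≤ T → ContainsSubdivK G t d))
  rooted-subdivision T {X} {D} {J} |X| le R =
    let J₁ , τ , le₁ , avoid = avoiding G D (target-count r T) X le (Rooted.apart R)
        d , d∈ , J₂ , σ , le₂ , choice = pigeonhole {R = Homogeneous} (upTo (r + r)) _
          (≤-trans (s≤s (*-monoˡ-≤ _ (≤-reflexive (length-upTo (r + r))))) le₁)
          (All.zipWith homogeneous (avoid ,
            All.zip (All-resp-⊆ τ (Rooted.linked R) , All-resp-⊆ τ (Rooted.c∈D R))))
        Y , Y∈ , J₃ , π , le₃ , good = pigeonhole {R = Chosen d} (sublists X) _
          (≤-trans (s≤s (*-monoˡ-≤ _ (≤-reflexive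
            (trans (length-sublists X) (cong (2 ^_) |X|))))) le₂)
          (All.map choose choice)
    in d , ∈-upTo⁻ d∈ ,
       conclude d Y (⊆-trans π (⊆-trans σ τ)) (All-resp-⊆ (⊆-trans π σ) avoid) le₃ good
    where
    Chosen : ℕ → List (Fin (n G)) → I → Set
    Chosen d Y j = Y ⊑ X × T ≤ length Y × AllPairs (Path G (D j) d) Y

    Homogeneous : ℕ → I → Set
    Homogeneous d j = ∃[ Y ] Chosen d Y j

    homogeneous : ∀ {j} → All (_∉ D j) X × All (λ x → Linked G r x (c j) (D j)) X × c j ∈ D j →
                  Any (λ d → Homogeneous d j) (upTo (r + r))
    homogeneous {j} (x∉ , links , c∈) =
      let d , d∈ , Y , Y⊑X , T≤ , paths = ramsey {R = Path G (D j)} (upTo (r + r)) T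
            (≤-reflexive (trans (cong (λ q → ramsey-bound q T) (length-upTo (r + r))) (≡-sym |X|)))
            (All⇒AllPairs (linked-path G c∈) (All.zip (links , x∉)))
      in lose d∈ (Y , Y⊑X , T≤ , paths)

    choose : ∀ {d j} → Homogeneous d j → Any (λ Y → Chosen d Y j) (sublists X)
    choose (Y , Y⊑X , rest) = lose (∈-sublists Y⊑X) (Y⊑X , rest)

    conclude : ∀ d Y {J′} → J′ ⊑ J → All (λ j → All (_∉ D j) X) J′ → suc (T * T) ≤ length J′ →
               All (Chosen d Y) J′ → ∀ t → t ≤ T → ContainsSubdivK G t d
    -- The list is nonempty even for `T = 0`, and its first member supplies `Y⊑X`.
    conclude d Y {J′ = J′} τ avoid lt good@((Y⊑X , T≤ , _) ∷ _) t t≤T =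
      subdivision G D t d Y J′ (AllPairs-resp-⊑ Y⊑X (Rooted.distinct R)) (≤-trans t≤T T≤)
        (≤-trans (*-mono-≤ t≤T t≤T) (<⇒≤ lt)) (AllPairs-resp-⊑ τ (Rooted.apart R))
        (All.map (All-resp-⊆ Y⊑X) avoid) (All.map (λ (_ , _ , paths) → paths) good)

  -- Which `d` occurs is not known beforehand, so all orders up to `T` are provided.
  play-subdivision : ∀ T {J} → play-bound r T ≤ length J → Play G c A P r J →
                     ∃[ d ] (d < r + r × (∀ t → t ≤ T → ContainsSubdivK G t d))
  play-subdivision T {J} le play =
    -- The start has no roots and singletons as sets, disjoint because the moves are distinct.
    let X , D , J′ , |X| , le′ , R = roots G c A P r (root-count r T) _ 1
          {D = λ i → c i ∷ []} le play
          (record { distinct = [] ; linked = All.universal (λ _ → []) J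
                  ; apart = AllPairs.map singletons (play-distinct G c A P r play)
                  ; c∈D = All.universal (λ _ → here refl) J })
          (All.universal (λ _ → []) J) (All.universal (λ _ → s≤s z≤n) J)
        |X|′ = trans |X| (+-identityʳ _)
    in rooted-subdivision T |X|′
         (≤-trans (≤-reflexive (cong (λ l → target-count r T + l * 2) |X|′)) le′) R
    where
    singletons : ∀ {i j} → c i ≢ c j → Disjoint (c i ∷ []) (c j ∷ [])
    singletons ne (here refl , here eq) = ne eq

-- Counting in lists

length-concatMap-≤ : ∀ {a b} {A : Set a} {B : Set b} (f : A → List B) k {xs} →
                     All (λ x → length (f x) ≤ k) xs → length (concatMap f xs) ≤ length xs * k
length-concatMap-≤ f k []                = z≤n
length-concatMap-≤ f k (_∷_ {x = x} p ps) =
  ≤-trans (≤-reflexive (length-++ (f x))) (+-mono-≤ p (length-concatMap-≤ f k ps))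

unique-length-≤ : ∀ {a} {A : Set a} {xs ys : List A} → Unique xs → All (_∈ ys) xs →
                  length xs ≤ length ys
unique-length-≤ {xs = xs} {ys} distinct xs∈ = injective⇒≤ {f = position} position-injective
  where
  xs[_]∈ : ∀ i → lookup xs i ∈ ys
  xs[ i ]∈ = All.lookup xs∈ (∈-lookup i)

  position : Fin (length xs) → Fin (length ys)
  position i = Any.index xs[ i ]∈

  position-injective : ∀ {i j} → position i ≡ position j → i ≡ j
  position-injective {i} {j} eq = AllPairs-lookup-≡ distinct (λ ne → ne eq′) (λ ne → ne (≡-sym eq′))
    where
    eq′ : lookup xs i ≡ lookup xs j
    eq′ = trans (lookup-index xs[ i ]∈)
                (trans (cong (lookup ys) eq) (≡-sym (lookup-index xs[ j ]∈)))

maxBelow : ℕ → (ℕ → ℕ) → ℕ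
maxBelow k f = max 0 (map f (upTo k))

≤-maxBelow : ∀ {k i} (f : ℕ → ℕ) → i < k → f i ≤ maxBelow k f
≤-maxBelow f i<k = v≤max⁺ 0 _ (inj₂ (lose (∈-map⁺ f (∈-upTo⁺ i<k)) ≤-refl))

-- The Splitter game

-- One round for the recorded move and one for each vertex of at most `N` walks.
round-cost : ℕ → ℕ → ℕ → ℕ
round-cost r N zero    = 0
round-cost r N (suc k) = suc (N * suc r + round-cost r N k)

-- `b + b * b` vertices from the smaller obstructions, a walk of at most `suc r` vertices to each,
-- and the move itself.
obstruction-bound : ℕ → ℕ → ℕ
obstruction-bound r zero    = 1
obstruction-bound r (suc ℓ) = suc ((b + b * b) * suc r)
  where
  b : ℕ
  b = obstruction-bound r ℓ

module _ (G : Graph) where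

  private
    V : Set
    V = Fin (n G)

  open import Data.List.Membership.DecPropositional (_≟_ {n G}) using (_∈?_)

  reach-mono : ∀ {S T : V → Set} → (∀ {v} → S v → T v) →
               ∀ {r u v} → Reach G S r u v → Reach G T r u v
  reach-mono S⊆T (here s)     = here (S⊆T s)
  reach-mono S⊆T (step s e ρ) = step (S⊆T s) e (reach-mono S⊆T ρ)

  reach-target : ∀ {S r u v} → Reach G S r u v → S v
  reach-target (here s)     = s
  reach-target (step _ _ ρ) = reach-target ρ

  reach-walk : ∀ {S r u v} → Reach G S r u v → ∃[ l ] (Walk G u l v × length l ≤ r × All S (u ∷ l))
  reach-walk (here s)     = [] , [] , z≤n , s ∷ []
  reach-walk (step s e ρ) =
    let l , w , l≤ , ss = reach-walk ρ in _ ∷ l , e ∷ w , s≤s l≤ , s ∷ ss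

  walk-reach : ∀ {S r u l v} → Walk G u l v → length l ≤ r → All S (u ∷ l) → Reach G S r u v
  walk-reach []      _        (s ∷ _)  = here s
  walk-reach (e ∷ w) (s≤s l≤) (s ∷ ss) = step s e (walk-reach w l≤ ss)

  reach? : ∀ {S} → Decidable S → ∀ r u v → Dec (Reach G S r u v)
  reach? S? zero u v with u ≟ v | S? u
  ... | yes refl | yes s = yes (here s)
  ... | yes refl | no ¬s = no λ { (here s) → ¬s s }
  ... | no u≢v   | _     = no λ { (here _) → u≢v refl }
  reach? S? (suc r) u v with S? u
  ... | no ¬s = no λ { (here s) → ¬s s ; (step s _ _) → ¬s s }
  ... | yes s with u ≟ v
  ...   | yes refl = yes (here s)
  ...   | no u≢v with any? (λ w → (adj G u w Bool.≟ true) ×-dec reach? S? r w v)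
  ...     | yes (w , e , ρ) = yes (step s e ρ)
  ...     | no ¬ρ           = no λ { (here _) → u≢v refl ; (step _ e ρ) → ¬ρ (_ , e , ρ) }

  module _ (r : ℕ) where

    Next : (V → Set) → V → V → V → Set
    Next S c s = Remove G (Ball G S r c) s

    next? : ∀ {S} → Decidable S → ∀ c s → Decidable (Next S c s)
    next? S? c s v = reach? S? r c v ×-dec ¬? (v ≟ s)

    -- Splitter copies the reply for `T`. A reply outside `S` is replaced by `c`, as it is absent
    -- from the ball in `S` anyway.
    wins-mono : ∀ ℓ {S T : V → Set} → Decidable S → (∀ {v} → S v → T v) →
                Wins G r T ℓ → Wins G r S ℓ
    wins-mono zero    S? S⊆T w v s = w v (S⊆T s)
    wins-mono (suc ℓ) S? S⊆T w c c∈ with w c (S⊆T c∈)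
    ... | s , _ , w′ with S? s
    ...   | yes s∈ = s , s∈ , wins-mono ℓ (next? S? c s) (λ (ρ , v≢s) → reach-mono S⊆T ρ , v≢s) w′
    ...   | no  s∉ = c , c∈ , wins-mono ℓ (next? S? c c)
      (λ (ρ , _) → reach-mono S⊆T ρ , λ { refl → s∉ (reach-target ρ) }) w′

    wins-≤ : ∀ {k ℓ S} → k ≤ ℓ → Wins G r S k → Wins G r S ℓ
    wins-≤ {zero}  {zero}  _          w      = w
    wins-≤ {zero}  {suc ℓ} _          w c c∈ = contradiction c∈ (w c)
    wins-≤ {suc k} {suc ℓ} (s≤s k≤ℓ) w c c∈ =
      let s , s∈ , w′ = w c c∈ in s , s∈ , wins-≤ k≤ℓ w′

    wins? : ∀ ℓ {S} → Decidable S → Dec (Wins G r S ℓ)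
    wins? zero    S? = all? (λ v → ¬? (S? v))
    wins? (suc ℓ) S? = all? (λ c → S? c →-dec any? (λ s → S? s ×-dec wins? ℓ (next? S? c s)))

    -- Splitter deletes `W` one vertex per round, whatever Connector plays; meanwhile the arena only
    -- shrinks. A vertex already gone is replaced by `c`.
    wins-minus : ∀ W ℓ {S} → Decidable S → Wins G r (λ v → S v × v ∉ W) ℓ →
                 Wins G r S (length W + ℓ)
    wins-minus []      ℓ S? w = wins-mono ℓ S? (λ s → s , λ ()) w
    wins-minus (x ∷ W) ℓ {S} S? w c c∈ with S? x
    ... | yes x∈ = x , x∈ , wins-minus W ℓ (next? S? c x) (wins-mono ℓ
      (λ v → next? S? c x v ×-dec ¬? (v ∈? W))
      (λ ((ρ , v≢x) , v∉W) → reach-target ρ , λ { (here eq) → v≢x eq ; (there v∈W) → v∉W v∈W }) w)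
    ... | no  x∉ = c , c∈ , wins-minus W ℓ (next? S? c c) (wins-mono ℓ
      (λ v → next? S? c c v ×-dec ¬? (v ∈? W))
      (λ ((ρ , _) , v∉W) → reach-target ρ ,
        λ { (here refl) → x∉ (reach-target ρ) ; (there v∈W) → v∉W v∈W }) w)

    -- Restricting to `Z` may destroy short walks from `c`; their vertices are added to keep `Z` in
    -- the ball.
    ball-hull : ∀ {S : V → Set} {c} Z → All (Reach G S r c) Z →
                ∃[ W ] (length W ≤ length Z * suc r × All S W × All (Reach G (_∈ W) r c) Z)
    ball-hull []      []       = [] , z≤n , [] , []
    ball-hull {c = c} (z ∷ Z) (ρ ∷ ρs) =
      let l , w , l≤ , ss = reach-walk ρ
          W , W≤ , ss′ , ρs′ = ball-hull Z ρs
      in (c ∷ l) ++ W ,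
         s≤s (≤-trans (≤-reflexive (length-++ l)) (+-mono-≤ l≤ W≤)) ,
         All.++⁺ ss ss′ ,
         walk-reach w l≤ (All.tabulate ∈-++⁺ˡ) ∷ All.map (reach-mono (∈-++⁺ʳ (c ∷ l))) ρs′

    obstruction : ∀ ℓ {S} → Decidable S → ¬ Wins G r S ℓ →
                  ∃[ Y ] (length Y ≤ obstruction-bound r ℓ × All S Y × ¬ Wins G r (_∈ Y) ℓ)
    obstruction zero S? ¬w with any? S?
    ... | yes (v , s) = v ∷ [] , ≤-refl , s ∷ [] , λ w → w v (here refl)
    ... | no  ¬s      = contradiction (λ v s → ¬s (v , s)) ¬w
    -- Winning is decidable, so a finite search finds a move `c` without a winning reply.
    obstruction (suc ℓ) {S} S? ¬w
      with ¬∀⟶∃¬ (n G) _ (λ c → S? c →-dec any? (λ s → S? s ×-dec wins? ℓ (next? S? c s))) ¬w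
    ... | c , ¬reply =
      c ∷ W , s≤s (≤-trans W≤ (*-monoˡ-≤ (suc r) Z≤)) , c∈ ∷ W⊆S , wins-hull
      where
      c∈ : S c
      c∈ = decidable-stable (S? c) λ c∉ → ¬reply λ c∈ → contradiction c∈ c∉

      -- For `s` outside `S` the reply `c` would do at least as well.
      loses : ∀ s → ¬ Wins G r (Next S c s) ℓ
      loses s w with S? s
      ... | yes s∈ = ¬reply λ _ → s , s∈ , w
      ... | no  s∉ = ¬reply λ _ → c , c∈ , wins-mono ℓ (next? S? c c)
        (λ (ρ , _) → ρ , λ { refl → s∉ (reach-target ρ) }) w

      b : ℕ
      b = obstruction-bound r ℓ

      core : ∀ s → ∃[ Y ] (length Y ≤ b × All (Next S c s) Y × ¬ Wins G r (_∈ Y) ℓ)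
      core s = obstruction ℓ (next? S? c s) (loses s)

      Y : V → List V
      Y s = proj₁ (core s)

      -- No vertex lies in all of the obstructions Y c and Y s, s ∈ Y c.
      Z : List V
      Z = Y c ++ concatMap Y (Y c)

      Z≤ : length Z ≤ b + b * b
      Z≤ = ≤-trans (≤-reflexive (length-++ (Y c))) (+-mono-≤ Yc≤
        (≤-trans (length-concatMap-≤ Y b (All.universal (λ s → proj₁ (proj₂ (core s))) (Y c)))
                 (*-monoˡ-≤ b Yc≤)))
        where
        Yc≤ : length (Y c) ≤ b
        Yc≤ = proj₁ (proj₂ (core c))

      Y⊆ball : ∀ s → All (Next S c s) (Y s)
      Y⊆ball s = proj₁ (proj₂ (proj₂ (core s)))

      Z⊆ball : All (Reach G S r c) Z
      Z⊆ball = All.++⁺ (All.map proj₁ (Y⊆ball c))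
        (All.concat⁺ (All.map⁺ (All.universal (λ s → All.map proj₁ (Y⊆ball s)) (Y c))))

      hull : ∃[ W ] (length W ≤ length Z * suc r × All S W × All (Reach G (_∈ W) r c) Z)
      hull = ball-hull Z Z⊆ball

      W : List V
      W = proj₁ hull

      W≤ : length W ≤ length Z * suc r
      W≤ = proj₁ (proj₂ hull)

      W⊆S : All S W
      W⊆S = proj₁ (proj₂ (proj₂ hull))

      reach-Z : ∀ {v} → v ∈ Z → Reach G (_∈ c ∷ W) r c v
      reach-Z v∈ = reach-mono there (All.lookup (proj₂ (proj₂ (proj₂ hull))) v∈)

      wins-hull : ¬ Wins G r (_∈ c ∷ W) (suc ℓ)
      wins-hull w with w c (here refl)
      -- `Y c` survives unless it contains `s`; in that case `Y s` survives, being chosen to avoid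
      -- `s`.
      ... | s , _ , w′ with s ∈? Y c
      ...   | no  s∉ = proj₂ (proj₂ (proj₂ (core c))) (wins-mono ℓ (_∈? Y c)
        (λ v∈ → reach-Z (∈-++⁺ˡ v∈) , λ { refl → s∉ v∈ }) w′)
      ...   | yes s∈ = proj₂ (proj₂ (proj₂ (core s))) (wins-mono ℓ (_∈? Y s)
        (λ v∈ → reach-Z (∈-++⁺ʳ (Y c) (∈-concatMap⁺ Y (lose s∈ v∈))) ,
                proj₂ (All.lookup (Y⊆ball s) v∈)) w′)

    -- Splitter's strategy

    record Entry : Set₁ where
      field
        arena  : V → Set
        arena? : Decidable arena
        centre : V
    open Entry

    -- The empty list is a default for centres out of reach; it does not arise between an earlier
    -- and a later move of a history.
    route : Entry → Entry → List V
    route e f with reach? (arena? e) r (centre e) (centre f)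
    ... | yes ρ = proj₁ (reach-walk ρ)
    ... | no  _ = []

    route-sees : ∀ e f → Reach G (arena e) r (centre e) (centre f) → Sees G centre arena route r e f
    route-sees e f ρ with reach? (arena? e) r (centre e) (centre f)
    ... | yes ρ′ = proj₂ (reach-walk ρ′)
    ... | no  ¬ρ = contradiction ρ ¬ρ

    route-≤ : ∀ e f → length (route e f) ≤ r
    route-≤ e f with reach? (arena? e) r (centre e) (centre f)
    ... | yes ρ = proj₁ (proj₂ (proj₂ (reach-walk ρ)))
    ... | no  _ = z≤n

    History : List Entry → Set₁
    History = Play G centre arena route r

    trace : Entry → Entry → List V
    trace e f = centre e ∷ route e f

    -- Invariant of the strategy at arena `S`: a further move in `S` is seen by all earlier ones,
    -- differs from them, and its arena misses their routes.
    record Open (es : List Entry) (S : V → Set) : Set₁ where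
      field
        history : History es
        inside  : All (λ e → ∀ v → S v → Reach G (arena e) r (centre e) v) es
        fresh   : All (λ e → ¬ S (centre e)) es
        clear   : AllPairs (λ e f → All (λ v → ¬ S v) (trace e f)) es
    open Open

    extend : ∀ {es S} → Open es S → (S? : Decidable S) → ∀ {c} → S c →
             History (es ++ [ record { arena = S ; arena? = S? ; centre = c } ])
    extend {S = S} o S? {c} c∈ = play-∷ʳ G centre arena route r (history o)
      (All.map (λ {f} reach → route-sees f _ (reach c c∈)) (inside o))
      (All.map (λ fresh eq → fresh (subst S (≡-sym eq) c∈)) (fresh o))
      (clear o)

    -- Connector's moves during the deletion of `W` are not recorded, so the history grows by one
    -- per stage. At `k = 0` a vertex of `S` would extend it to length at least `N`.
    splitter-wins : ∀ N → (∀ {es} → History es → length es < N) →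
                    ∀ k {es S} → Decidable S → Open es S → N ≤ length es + suc k →
                    Wins G r S (round-cost r N k)
    splitter-wins N bound zero {es} S? o N≤ v v∈ =
      <⇒≱ (bound (extend o S? v∈)) (≤-trans N≤ (≤-reflexive (≡-sym (length-++ es))))
    splitter-wins N bound (suc k) {es} {S} S? o N≤ c c∈ =
      c , c∈ , wins-≤ (+-monoˡ-≤ _ W≤) (wins-minus W _ (next? S? c c)
        (splitter-wins N bound k (λ v → next? S? c c v ×-dec ¬? (v ∈? W)) o′ N≤′))
      where
      e : Entry
      e = record { arena = S ; arena? = S? ; centre = c }

      W : List V
      W = concatMap (λ f → trace f e) es

      W≤ : length W ≤ N * suc r
      W≤ = ≤-trans (length-concatMap-≤ _ (suc r) (All.universal (λ f → s≤s (route-≤ f e)) es))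
                   (*-monoˡ-≤ (suc r) (<⇒≤ (bound (history o))))

      S′ : V → Set
      S′ v = Next S c c v × v ∉ W

      S′⊆S : ∀ {v} → S′ v → S v
      S′⊆S ((ρ , _) , _) = reach-target ρ

      N≤′ : N ≤ length (es ++ [ e ]) + suc k
      N≤′ = ≤-trans N≤ (≤-reflexive (≡-sym
        (trans (cong (_+ suc k) (length-++ es)) (+-assoc (length es) 1 (suc k)))))

      o′ : Open (es ++ [ e ]) S′
      o′ = record
        { history = extend o S? c∈
        ; inside  = All.∷ʳ⁺ (All.map (λ reach v s → reach v (S′⊆S s)) (inside o))
                            (λ _ ((ρ , _) , _) → ρ)
        ; fresh   = All.∷ʳ⁺ (All.map (λ ¬s s → ¬s (S′⊆S s)) (fresh o))
                            (λ ((_ , c≢c) , _) → c≢c refl)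
        ; clear   = AllPairs.++⁺ (AllPairs.map (All.map (λ ¬s s → ¬s (S′⊆S s))) (clear o)) ([] ∷ [])
            (All.tabulate λ f∈ →
               All.tabulate (λ v∈ (_ , v∉W) → v∉W (∈-concatMap⁺ _ (lose f∈ v∈))) ∷ [])
        }

  splitter-bounded : ∀ r T → (∀ d → d < r + r → ∃[ t ] (t ≤ T × ¬ ContainsSubdivK G t d)) →
                     Wins G r (AllV G) (round-cost r (play-bound r T) (play-bound r T))
  splitter-bounded r T free = splitter-wins r N bound N (λ _ → yes tt)
    (record { history = [] ; inside = [] ; fresh = [] ; clear = [] }) (n≤1+n N)
    where
    N : ℕ
    N = play-bound r T
    bound : ∀ {es} → History r es → length es < N
    bound {es} h with N ≤? length es
    ... | no  N≰ = ≰⇒> N≰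
    ... | yes N≤ =
      let d , d< , contains = play-subdivision G _ _ _ r T N≤ h
          t , t≤ , ¬contains = free d d<
      in contradiction (contains t t≤) ¬contains

theorem6 : (𝒞 : Graph → Set) → NowhereDense 𝒞 → (r : ℕ) →
    ∃[ k ] (∀ (G : Graph) → 𝒞 G → (c : Fin (n G)) → (xs : List (Fin (n G))) →
    Unique xs → All (Progressing G r c) xs → length xs ≤ k)
-- The ball's Splitter number varies with `G` and `c` but is at most `L`, hence the maximum.
theorem6 𝒞 nd r = maxBelow (suc L) (obstruction-bound r) , bounded
  where
  T L : ℕ
  -- Large enough for every subdivision length that a long play can produce.
  T = maxBelow (r + r) (λ d → proj₁ (nd d))
  L = round-cost r (play-bound r T) (play-bound r T)

  bounded : ∀ G → 𝒞 G → (c : Fin (n G)) (xs : List (Fin (n G))) → Unique xs →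
            All (Progressing G r c) xs → length xs ≤ maxBelow (suc L) (obstruction-bound r)
  bounded G G∈ c []       _        _  = z≤n
  -- The first vertex supplies the Splitter number of the ball, a successor because it exceeds
  -- another number.
  bounded G G∈ c (x ∷ xs) distinct ps@((_ , suc m , _ , (w , minimal) , _) ∷ _) =
    ≤-trans (unique-length-≤ distinct (All.map progressing-∈ ps))
            (≤-trans Y≤ (≤-maxBelow (obstruction-bound r) m<))
    where
    open import Data.List.Membership.DecPropositional (_≟_ {n G}) using (_∈?_)

    ball : Fin (n G) → Set
    ball = Ball G (AllV G) r c

    ball? : Decidable ball
    ball? = reach? G (λ _ → yes tt) r c

    m< : m < suc L
    m< = m≤n⇒m≤1+n (minimal L (wins-mono G r L ball? (λ _ → tt)
      (splitter-bounded G r T λ d d< → _ , ≤-maxBelow (λ d → proj₁ (nd d)) d< , proj₂ (nd d) G G∈)))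

    core : ∃[ Y ] (length Y ≤ obstruction-bound r m × All ball Y × ¬ Wins G r (_∈ Y) m)
    core = obstruction G r m ball? λ w → 1+n≰n (minimal m w)

    Y : List (Fin (n G))
    Y = proj₁ core

    Y≤ : length Y ≤ obstruction-bound r m
    Y≤ = proj₁ (proj₂ core)

    -- If `s` misses `Y`, then `Y` lies in the ball without `s`, where Splitter wins within `m`
    -- rounds.
    progressing-∈ : ∀ {s} → Progressing G r c s → s ∈ Y
    progressing-∈ {s} (m₁ , m₂ , (w₁ , _) , (_ , minimal₂) , m₁<m₂) =
      decidable-stable (s ∈? Y) λ s∉Y →
        let ball⊇Y , ¬wins = proj₂ (proj₂ core)
        in ¬wins (wins-mono G r m (_∈? Y)
             (λ v∈ → All.lookup ball⊇Y v∈ , λ { refl → s∉Y v∈ })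
             (wins-≤ G r (≤-pred (≤-trans m₁<m₂ (minimal₂ (suc m) w))) w₁))
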